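{- For any graphs $G$ and $H$, (i) $\rho_e^o(G\,\square\,H)\ge \max\{\rho_e^o(G)\,\alpha(H),\ \alpha(G)\,\rho_e^o(H)\}$, and (ii) $\rho_e^o(G\boxtimes H)\ge \max\{\rho_e^o(G)\,\alpha(H),\ \rho_e^o(H)\,\alpha(G)\}$. These bounds are sharp, that is, each of the bounds in (i) and (ii) is attained with equality by some graphs $G$ and $H$.
   Context: All graphs are finite and simple. A set $B\subseteq E(G)$ is an edge open packing set (EOP set) of $G$ if for any two distinct edges $e_1,e_2\in B$ there is no edge $e\in E(G)\setminus\{e_1,e_2\}$ joining an endvertex of $e_1$ to an endvertex of $e_2$ (that is, no edge $e$ such that $e_1,e,e_2$ form a path with middle edge $e$ or a triangle). Edges of $B$ may share an endvertex. The maximum cardinality of an EOP set is the EOP number $\rho_e^o(G)$. $\alpha(G)$ is the independence number of $G$. The following products of $G$ and $H$ have vertex set $V(G)\times V(H)$. In the Cartesian product $G\,\square\,H$ two vertices are adjacent if they are adjacent in one coordinate and equal in the other. In the direct product $G\times H$ two vertices are adjacent if they are adjacent in both coordinates. The edge set of the strong product $G\boxtimes H$ is $E(G\,\square\,H)\cup E(G\times H)$. -}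

module Defs where

open import Data.Nat using (ℕ; _*_)
open import Data.Fin using (Fin; _<_)
open import Data.Fin.Properties using (_<?_; *↔×)
import Data.Fin.Properties as Fin
open import Data.List using (List; []; _∷_; _++_; map; filter; length; allFin; cartesianProduct)
open import Data.List.Extrema.Nat using (max)
open import Data.List.Relation.Unary.All using (All; all?)
open import Data.Product using (_×_; _,_; proj₁; proj₂)
open import Data.Product.Function.NonDependent.Propositional using (_×-↔_)
open import Data.Product.Properties using (≡-dec)
open import Data.Sum using (_⊎_; inj₁; inj₂)
import Data.Sum as Sum
open import Function using (_∘_)
open import Function.Bundles using (_↔_; Inverse)
open import Function.Construct.Composition using (_↔-∘_)
open import Function.Construct.Symmetry using (↔-sym)
open import Function.Properties.Inverse using (↔⇒↣)
open import Level using (0ℓ)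
open import Relation.Binary using (Decidable; DecidableEquality; Symmetric)
open import Relation.Binary.PropositionalEquality using (_≡_; _≢_; refl; sym)
open import Relation.Nullary using (¬_; Dec)
open import Relation.Nullary.Decidable using (_×-dec_; _⊎-dec_; _→-dec_; ¬?; via-injection)
open import Relation.Unary using (Pred)
import Relation.Unary as U

------------------------------------------------------------------------
-- Finite simple graphs

record Graph : Set₁ where
  infix 4 _~_ _~?_ _≟_
  field
    V        : Set
    order    : ℕ
    index    : V ↔ Fin order
    _~_      : V → V → Set
    _~?_     : Decidable _~_
    ~-sym    : Symmetric _~_
    ~-irrefl : ∀ {u} → ¬ (u ~ u)

  _≟_ : DecidableEquality V
  _≟_ = via-injection (↔⇒↣ index) Fin._≟_

  vertices : List V
  vertices = map (Inverse.from index) (allFin order)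

  -- Each edge {u , v} is represented once, by the pair listing its
  -- endvertex of smaller index first.  Hence distinct edges are the
  -- same thing as distinct pairs in the list edges.
  Ascending : Pred (V × V) 0ℓ
  Ascending (u , v) = Inverse.to index u < Inverse.to index v

  edge? : U.Decidable (λ (e : V × V) → proj₁ e ~ proj₂ e × Ascending e)
  edge? (u , v) = (u ~? v) ×-dec (Inverse.to index u <? Inverse.to index v)

  edges : List (V × V)
  edges = filter edge? (cartesianProduct vertices vertices)

------------------------------------------------------------------------
-- Maximum cardinality of a subset with a given property

-- When xs has no repetitions, sublists xs lists each subset of xs
-- exactly once, and the length of a sublist is its cardinality.
sublists : ∀ {A : Set} → List A → List (List A)
sublists []       = [] ∷ []
sublists (x ∷ xs) = map (x ∷_) (sublists xs) ++ sublists xs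

-- The default value 0 only matters if no sublist satisfies P; the
-- properties used below all hold of the empty sublist.
maxCard : ∀ {A : Set} {P : Pred (List A) 0ℓ} → U.Decidable P → List A → ℕ
maxCard P? xs = max 0 (map length (filter P? (sublists xs)))

------------------------------------------------------------------------
-- Independence number and edge open packing number

module _ (G : Graph) where
  open Graph G

  Independent : List V → Set
  Independent S = All (λ u → All (λ v → ¬ (u ~ v)) S) S

  independent? : U.Decidable Independent
  independent? S = all? (λ u → all? (λ v → ¬? (u ~? v)) S) S

  α : ℕ
  α = maxCard independent? vertices

  EndvertexOf : V → V × V → Set
  EndvertexOf w (u , v) = w ≡ u ⊎ w ≡ v

  endvertexOf? : Decidable EndvertexOf
  endvertexOf? w (u , v) = (w ≟ u) ⊎-dec (w ≟ v)

  Joins : V × V → V × V → V × V → Set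
  Joins (a , b) e₁ e₂ = (EndvertexOf a e₁ × EndvertexOf b e₂)
                      ⊎ (EndvertexOf b e₁ × EndvertexOf a e₂)

  joins? : ∀ e e₁ e₂ → Dec (Joins e e₁ e₂)
  joins? (a , b) e₁ e₂ = (endvertexOf? a e₁ ×-dec endvertexOf? b e₂)
                   ⊎-dec (endvertexOf? b e₁ ×-dec endvertexOf? a e₂)

  EdgeOpenPacking : List (V × V) → Set
  EdgeOpenPacking B =
    All (λ e₁ → All (λ e₂ → e₁ ≢ e₂ →
      All (λ e → e ≢ e₁ × e ≢ e₂ → ¬ Joins e e₁ e₂) edges) B) B

  infix 4 _≟ₑ_
  _≟ₑ_ : DecidableEquality (V × V)
  _≟ₑ_ = ≡-dec _≟_ _≟_

  edgeOpenPacking? : U.Decidable EdgeOpenPacking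
  edgeOpenPacking? B =
    all? (λ e₁ → all? (λ e₂ → ¬? (e₁ ≟ₑ e₂) →-dec
      all? (λ e → (¬? (e ≟ₑ e₁) ×-dec ¬? (e ≟ₑ e₂)) →-dec
                  ¬? (joins? e e₁ e₂)) edges) B) B

  ρₑᵒ : ℕ
  ρₑᵒ = maxCard edgeOpenPacking? edges

------------------------------------------------------------------------
-- Graph products

module _ (G H : Graph) where
  private
    module G = Graph G
    module H = Graph H

  productIndex : (G.V × H.V) ↔ Fin (G.order * H.order)
  productIndex = ↔-sym *↔× ↔-∘ (G.index ×-↔ H.index)

  CartesianAdj DirectAdj StrongAdj : G.V × H.V → G.V × H.V → Set
  CartesianAdj (g , h) (g′ , h′) = (g G.~ g′ × h ≡ h′) ⊎ (g ≡ g′ × h H.~ h′)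
  DirectAdj    (g , h) (g′ , h′) = g G.~ g′ × h H.~ h′
  StrongAdj    x       y         = CartesianAdj x y ⊎ DirectAdj x y

  cartesianAdj? : Decidable CartesianAdj
  cartesianAdj? (g , h) (g′ , h′) = ((g G.~? g′) ×-dec (h H.≟ h′))
                              ⊎-dec ((g G.≟ g′) ×-dec (h H.~? h′))

  directAdj? : Decidable DirectAdj
  directAdj? (g , h) (g′ , h′) = (g G.~? g′) ×-dec (h H.~? h′)

  cartesianAdj-sym : Symmetric CartesianAdj
  cartesianAdj-sym (inj₁ (p , q)) = inj₁ (G.~-sym p , sym q)
  cartesianAdj-sym (inj₂ (p , q)) = inj₂ (sym p , H.~-sym q)

  directAdj-sym : Symmetric DirectAdj
  directAdj-sym (p , q) = G.~-sym p , H.~-sym q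

  cartesianAdj-irrefl : ∀ {x} → ¬ CartesianAdj x x
  cartesianAdj-irrefl (inj₁ (p , _)) = G.~-irrefl p
  cartesianAdj-irrefl (inj₂ (_ , q)) = H.~-irrefl q

  infixr 7 _□_ _⊠_

  _□_ : Graph
  _□_ = record
    { V        = G.V × H.V
    ; order    = G.order * H.order
    ; index    = productIndex
    ; _~_      = CartesianAdj
    ; _~?_     = cartesianAdj?
    ; ~-sym    = cartesianAdj-sym
    ; ~-irrefl = cartesianAdj-irrefl
    }

  _⊠_ : Graph
  _⊠_ = record
    { V        = G.V × H.V
    ; order    = G.order * H.order
    ; index    = productIndex
    ; _~_      = StrongAdj
    ; _~?_     = λ x y → cartesianAdj? x y ⊎-dec directAdj? x y
    ; ~-sym    = Sum.map cartesianAdj-sym directAdj-sym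
    ; ~-irrefl = Sum.[ cartesianAdj-irrefl , G.~-irrefl ∘ proj₁ ]
    }

{-# OPTIONS --safe #-}
module Submission where

-- Let B be a maximum edge open packing set of G and S a maximum independent set
-- of H. Copy B into the layer of every h in S. An edge of the product between the
-- layers of h and h′ in S forces h ~ h′ or h ≡ h′; the former is impossible in S,
-- and in the latter case the edge lies inside one layer, where B is a packing.
-- Only this layer structure is used, so both products and both factors are
-- covered by one argument.

open import Defs
open import Data.Nat using (ℕ; _≤_; _<_; _≥_; _>_; _+_; _*_; _⊔_; z≤n; s≤s)
open import Data.Nat.Properties
  using (≤-trans; ≤-reflexive; *-comm; ⊔-lub; +-monoʳ-<; module ≤-Reasoning)
open import Data.Fin using (Fin; combine)
import Data.Fin as Fin
import Data.Fin.Properties as Fin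
open import Data.List
  using (List; []; _∷_; map; filter; length; lookup; cartesianProduct;
         cartesianProductWith)
open import Data.List.Extrema.Nat using (xs≤max; argmax-sel)
open import Data.List.Properties using (length-++; length-map)
open import Data.List.Membership.Propositional using (_∈_)
import Data.List.Membership.DecPropositional as DecMembership
open import Data.List.Membership.Propositional.Properties
  using (∈-map⁺; ∈-map⁻; ∈-++⁺ˡ; ∈-++⁺ʳ; ∈-++⁻; ∈-filter⁺; ∈-filter⁻; ∈-lookup;
         ∈-allFin; ∈-cartesianProduct⁺; ∈-cartesianProductWith⁻)
open import Data.List.Relation.Binary.Sublist.Propositional
  using ([]; _∷_; _∷ʳ_) renaming (_⊆_ to _⊑_; lookup to ⊑-lookup; minimum to ⊑-minimum)
open import Data.List.Relation.Binary.Sublist.Propositional.Properties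
  using (filter-⊆) renaming (All-resp-⊆ to All-resp-⊑)
open import Data.List.Relation.Binary.Subset.Propositional using (_⊆_; _⊇_)
open import Data.List.Relation.Binary.Subset.Propositional.Properties using (All-resp-⊇)
open import Data.List.Relation.Unary.All as All using (All; []; _∷_)
open import Data.List.Relation.Unary.AllPairs using ([]; _∷_)
open import Data.List.Relation.Unary.Any using (here) renaming (index to position)
open import Data.List.Relation.Unary.Any.Properties using (lookup-index)
open import Data.List.Relation.Unary.Unique.Propositional using (Unique)
import Data.List.Relation.Unary.Unique.Propositional.Properties as Unique
open import Data.Empty using (⊥)
open import Data.Product using (_×_; _,_; ∃-syntax; proj₁; proj₂; swap)
open import Data.Product.Properties using (,-injective)
open import Data.Sum using (_⊎_; inj₁; inj₂)
open import Function using (_∘_; flip; id)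
open import Function.Bundles using (Injection; Inverse)
open import Function.Construct.Identity using (↔-id)
open import Function.Construct.Symmetry using (↔-sym)
open import Function.Properties.Inverse using (↔⇒↣)
open import Level using (0ℓ)
open import Relation.Binary using (DecidableEquality; tri<; tri≈; tri>; _Respects_)
open import Relation.Binary.PropositionalEquality
  using (_≡_; _≢_; refl; sym; trans; cong; cong₂; subst; subst₂)
open import Relation.Nullary using (¬_; contradiction; no)
open import Relation.Nullary.Decidable using (¬?)
open import Relation.Unary using (Pred)
import Relation.Unary as U

private
  variable
    A B C : Set

-- Lengths of lists without repetitions.

length-cartesianProductWith : (f : A → B → C) (xs : List A) (ys : List B) →
  length (cartesianProductWith f xs ys) ≡ length xs * length ys
length-cartesianProductWith f []       ys = refl
length-cartesianProductWith f (x ∷ xs) ys =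
  trans (length-++ (map (f x) ys))
        (cong₂ _+_ (length-map (f x) ys) (length-cartesianProductWith f xs ys))

Unique-resp-⊑ : {xs ys : List A} → ys ⊑ xs → Unique xs → Unique ys
Unique-resp-⊑ []         _          = []
Unique-resp-⊑ (_ ∷ʳ s)   (_ ∷ u)    = Unique-resp-⊑ s u
Unique-resp-⊑ (refl ∷ s) (x≢xs ∷ u) = All-resp-⊑ s x≢xs ∷ Unique-resp-⊑ s u

lookup-injective : {xs : List A} → Unique xs → ∀ {i j} → lookup xs i ≡ lookup xs j → i ≡ j
lookup-injective (_ ∷ _)     {Fin.zero}  {Fin.zero}  _  = refl
lookup-injective (x≢xs ∷ _)  {Fin.zero}  {Fin.suc j} eq =
  contradiction eq (All.lookup x≢xs (∈-lookup j))
lookup-injective (x≢xs ∷ _)  {Fin.suc i} {Fin.zero}  eq =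
  contradiction (sym eq) (All.lookup x≢xs (∈-lookup i))
lookup-injective (_ ∷ u)     {Fin.suc i} {Fin.suc j} eq = cong Fin.suc (lookup-injective u eq)

-- Pigeonhole: each index of `xs` is sent to a position in `ys` that holds the same entry.
-- Uniqueness of `xs` makes this map between finite sets injective.
length-mono-⊆ : {xs ys : List A} → Unique xs → xs ⊆ ys → length xs ≤ length ys
length-mono-⊆ {xs = xs} {ys} u xs⊆ys = Fin.injective⇒≤ {f = λ i → position (xs⊆ys (∈-lookup i))}
  λ {i} {j} eq → lookup-injective u
    (trans (lookup-index (xs⊆ys (∈-lookup i)))
    (trans (cong (lookup ys) eq)
           (sym (lookup-index (xs⊆ys (∈-lookup j))))))

-- Sublists and the maximum `maxCard`.

∈-sublists⁺ : {xs ys : List A} → ys ⊑ xs → ys ∈ sublists xs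
∈-sublists⁺ []                       = here refl
∈-sublists⁺ {xs = x ∷ xs} (_ ∷ʳ s)   = ∈-++⁺ʳ (map (x ∷_) (sublists xs)) (∈-sublists⁺ s)
∈-sublists⁺ {xs = x ∷ xs} (refl ∷ s) = ∈-++⁺ˡ (∈-map⁺ (x ∷_) (∈-sublists⁺ s))

∈-sublists⁻ : (xs : List A) {ys : List A} → ys ∈ sublists xs → ys ⊑ xs
∈-sublists⁻ []       (here refl) = []
∈-sublists⁻ (x ∷ xs) p with ∈-++⁻ (map (x ∷_) (sublists xs)) p
... | inj₁ q with _ , r , refl ← ∈-map⁻ (x ∷_) q = refl ∷ ∈-sublists⁻ xs r
... | inj₂ q = x ∷ʳ ∈-sublists⁻ xs q

module _ {P : Pred (List A) 0ℓ} (P? : U.Decidable P) where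

  -- A maximum over a list is an entry of it or the default value 0; in the latter case `[]` is the
  -- witness, hence the hypothesis `P []`.
  maxCard-attained : P [] → ∀ xs → ∃[ ys ] (ys ⊑ xs × P ys × length ys ≡ maxCard P? xs)
  maxCard-attained P[] xs
    with argmax-sel id 0 (map length (filter P? (sublists xs)))
  ... | inj₁ max≡0 = [] , ⊑-minimum xs , P[] , sym max≡0
  ... | inj₂ max∈
    with ys , ys∈ , max≡ ← ∈-map⁻ length max∈
    with ys∈sub , Pys ← ∈-filter⁻ P? ys∈
    = ys , ∈-sublists⁻ xs ys∈sub , Pys , sym max≡

  length≤maxCard : ∀ {xs ys} → ys ⊑ xs → P ys → length ys ≤ maxCard P? xs
  length≤maxCard ys⊑xs Pys =
    All.lookup (xs≤max 0 _) (∈-map⁺ length (∈-filter⁺ P? (∈-sublists⁺ ys⊑xs) Pys))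

  -- `maxCard` sees only sublists, which keep the order of `xs`, while `ys` may be ordered
  -- differently. Filtering `xs` by membership in `ys` restores the order: the result contains all
  -- of `ys`, so it is at least as long, and has no other entries, so it inherits `P`.
  length≤maxCard-⊆ : DecidableEquality A → P Respects _⊇_ →
    ∀ {xs ys} → Unique ys → ys ⊆ xs → P ys → length ys ≤ maxCard P? xs
  length≤maxCard-⊆ _≟_ resp {xs} {ys} u ys⊆xs Pys = ≤-trans
    (length-mono-⊆ u λ y∈ys → ∈-filter⁺ (_∈? ys) (ys⊆xs y∈ys) y∈ys)
    (length≤maxCard (filter-⊆ (_∈? ys) xs) (resp (proj₂ ∘ ∈-filter⁻ (_∈? ys) {xs = xs}) Pys))
    where open DecMembership _≟_ using (_∈?_)

-- Vertex and edge lists of a graph.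

module GraphProperties (G : Graph) where
  open Graph G
  open Inverse index using (to; from; strictlyInverseʳ)

  vertices-unique : Unique vertices
  vertices-unique =
    Unique.map⁺ (Injection.injective (↔⇒↣ (↔-sym index))) (Unique.allFin⁺ order)

  ∈-vertices : ∀ v → v ∈ vertices
  ∈-vertices v = subst (_∈ vertices) (strictlyInverseʳ v) (∈-map⁺ from (∈-allFin (to v)))

  edges-unique : Unique edges
  edges-unique = Unique.filter⁺ edge? (Unique.cartesianProduct⁺ vertices-unique vertices-unique)

  ∈-edges⁺ : ∀ {u v} → u ~ v → Ascending (u , v) → (u , v) ∈ edges
  ∈-edges⁺ u~v u<v =
    ∈-filter⁺ edge? (∈-cartesianProduct⁺ (∈-vertices _) (∈-vertices _)) (u~v , u<v)

  ∈-edges⁻ : ∀ {e} → e ∈ edges → proj₁ e ~ proj₂ e × Ascending e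
  ∈-edges⁻ = proj₂ ∘ ∈-filter⁻ edge? {xs = cartesianProduct vertices vertices}

  edgeOpenPacking-resp-⊇ : EdgeOpenPacking G Respects _⊇_
  edgeOpenPacking-resp-⊇ ⊆ = All-resp-⊇ ⊆ ∘ All.map (All-resp-⊇ ⊆)

-- Copying a packing into layers.

module _ (G H K : Graph) where
  private
    module G = Graph G
    module H = Graph H
    module K = Graph K
    module GP = GraphProperties G
    module HP = GraphProperties H
    module KP = GraphProperties K

  -- The diagonal edges of the strong product fit `~-layer⁻` through its first case. `ascending⁺` is
  -- there because `edges` lists each edge only in its ascending orientation, which copying must
  -- preserve.
  module Layers
    (_⊗_ : G.V → H.V → K.V)
    (⊗-injective : ∀ {g h g′ h′} → g ⊗ h ≡ g′ ⊗ h′ → g ≡ g′ × h ≡ h′)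
    (~-layer⁺ : ∀ {g g′ h} → g G.~ g′ → (g ⊗ h) K.~ (g′ ⊗ h))
    (~-layer⁻ : ∀ {g g′ h h′} → (g ⊗ h) K.~ (g′ ⊗ h′) → h H.~ h′ ⊎ (h ≡ h′ × g G.~ g′))
    (ascending⁺ : ∀ {g g′ h} → G.Ascending (g , g′) → K.Ascending (g ⊗ h , g′ ⊗ h))
    where

    layer : G.V × G.V → H.V → K.V × K.V
    layer (u , v) h = u ⊗ h , v ⊗ h

    layer-injective : ∀ {e h e′ h′} → layer e h ≡ layer e′ h′ → e ≡ e′ × h ≡ h′
    layer-injective eq with eq₁ , eq₂ ← ,-injective eq
      = cong₂ _,_ (proj₁ (⊗-injective eq₁)) (proj₁ (⊗-injective eq₂)) , proj₂ (⊗-injective eq₁)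

    -- Trichotomy: a descending pair would be copied to a descending pair, and equal indices would
    -- make g adjacent to itself.
    ascending⁻ : ∀ {g g′ h} → g G.~ g′ → K.Ascending (g ⊗ h , g′ ⊗ h) → G.Ascending (g , g′)
    ascending⁻ {g} {g′} g~g′ lt with Fin.<-cmp (Inverse.to G.index g) (Inverse.to G.index g′)
    ... | tri< g<g′ _ _ = g<g′
    ... | tri> _ _ g′<g = contradiction (ascending⁺ g′<g) (Fin.<-asym lt)
    ... | tri≈ _ eq _   = contradiction g~g′
      (subst (λ x → ¬ (g G.~ x)) (Injection.injective (↔⇒↣ G.index) eq) G.~-irrefl)

    layer∈edges : ∀ {e h} → e ∈ G.edges → layer e h ∈ K.edges
    layer∈edges e∈ with e~ , e< ← GP.∈-edges⁻ e∈ = KP.∈-edges⁺ (~-layer⁺ e~) (ascending⁺ e<)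

    -- The packing property of `B` quantifies over the list `G.edges`, so adjacency alone would not
    -- do in the second case.
    edges⁻ : ∀ {g g′ h h′} → (g ⊗ h , g′ ⊗ h′) ∈ K.edges →
      h H.~ h′ ⊎ (h ≡ h′ × (g , g′) ∈ G.edges)
    edges⁻ e∈ with e~ , e< ← KP.∈-edges⁻ e∈ with ~-layer⁻ e~
    ... | inj₁ h~h′          = inj₁ h~h′
    ... | inj₂ (refl , g~g′) = inj₂ (refl , GP.∈-edges⁺ g~g′ (ascending⁻ g~g′ e<))

    -- A vertex of `K` need not have the form `g ⊗ h`; for endvertices of copied edges this form is
    -- recovered, so that `edges⁻` applies.
    endvertexOf-layer : ∀ {w} e {h} → EndvertexOf K w (layer e h) →
      ∃[ g ] (w ≡ g ⊗ h × EndvertexOf G g e)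
    endvertexOf-layer (u , v) (inj₁ w≡) = u , w≡ , inj₁ refl
    endvertexOf-layer (u , v) (inj₂ w≡) = v , w≡ , inj₂ refl

    module _ {B S} (packing : EdgeOpenPacking G B) (independent : Independent H S) where

      layers-packing : EdgeOpenPacking K (cartesianProductWith layer B S)
      layers-packing =
        All.tabulate λ e₁∈ → All.tabulate λ e₂∈ e₁≢e₂ → All.tabulate λ e∈ (e≢e₁ , e≢e₂) →
          disjoint e₁∈ e₂∈ e₁≢e₂ e∈ e≢e₁ e≢e₂
        where
        nonAdjacent : ∀ {h h′} → h ∈ S → h′ ∈ S → ¬ (h H.~ h′)
        nonAdjacent h∈ h′∈ = All.lookup (All.lookup independent h∈) h′∈

        notJoined : ∀ {e₁ e₂ e h} → e₁ ∈ B → e₂ ∈ B → layer e₁ h ≢ layer e₂ h → e ∈ G.edges →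
          layer e h ≢ layer e₁ h → layer e h ≢ layer e₂ h → ¬ Joins G e e₁ e₂
        notJoined {h = h} e₁∈ e₂∈ e₁≢e₂ e∈ e≢e₁ e≢e₂ =
          -- Equal edges have equal copies, so distinct copies in one layer come from distinct
          -- edges, as the packing property of `B` demands.
          All.lookup
            (All.lookup (All.lookup packing e₁∈) e₂∈ (e₁≢e₂ ∘ cong (flip layer h)))
            e∈ (e≢e₁ ∘ cong (flip layer h) , e≢e₂ ∘ cong (flip layer h))

        disjoint : ∀ {e₁ e₂ e} →
          e₁ ∈ cartesianProductWith layer B S → e₂ ∈ cartesianProductWith layer B S → e₁ ≢ e₂ →
          e ∈ K.edges → e ≢ e₁ → e ≢ e₂ → ¬ Joins K e e₁ e₂
        disjoint e₁∈ e₂∈ e₁≢e₂ e∈ e≢e₁ e≢e₂ joins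
          with f₁ , h₁ , f₁∈ , h₁∈ , refl ← ∈-cartesianProductWith⁻ layer B S e₁∈
             | f₂ , h₂ , f₂∈ , h₂∈ , refl ← ∈-cartesianProductWith⁻ layer B S e₂∈
          with joins
        -- The joining edge starts in layer h₁ and ends in layer h₂.
        ... | inj₁ (a∈e₁ , b∈e₂)
          with _ , refl , x∈f₁ ← endvertexOf-layer f₁ a∈e₁
             | _ , refl , y∈f₂ ← endvertexOf-layer f₂ b∈e₂
          with edges⁻ e∈
        ...   | inj₁ h₁~h₂        = nonAdjacent h₁∈ h₂∈ h₁~h₂
        ...   | inj₂ (refl , xy∈) =
          notJoined f₁∈ f₂∈ e₁≢e₂ xy∈ e≢e₁ e≢e₂ (inj₁ (x∈f₁ , y∈f₂))
        -- The opposite orientation: the joining edge starts in layer h₂ and ends in layer h₁.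
        disjoint e₁∈ e₂∈ e₁≢e₂ e∈ e≢e₁ e≢e₂ joins
            | inj₂ (b∈e₁ , a∈e₂)
          with _ , refl , y∈f₁ ← endvertexOf-layer f₁ b∈e₁
             | _ , refl , x∈f₂ ← endvertexOf-layer f₂ a∈e₂
          with edges⁻ e∈
        ...   | inj₁ h₂~h₁        = nonAdjacent h₂∈ h₁∈ h₂~h₁
        ...   | inj₂ (refl , xy∈) =
          notJoined f₁∈ f₂∈ e₁≢e₂ xy∈ e≢e₁ e≢e₂ (inj₂ (y∈f₁ , x∈f₂))

    ρₑᵒ*α≤ρₑᵒ : ρₑᵒ G * α H ≤ ρₑᵒ K
    ρₑᵒ*α≤ρₑᵒ
      with B , B⊑ , packing , |B|≡ ← maxCard-attained (edgeOpenPacking? G) [] G.edges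
         | S , S⊑ , independent , |S|≡ ← maxCard-attained (independent? H) [] H.vertices
      = begin
      ρₑᵒ G * α H                             ≡⟨ cong₂ _*_ |B|≡ |S|≡ ⟨
      length B * length S                     ≡⟨ length-cartesianProductWith layer B S ⟨
      length (cartesianProductWith layer B S) ≤⟨ length≤maxCard-⊆ (edgeOpenPacking? K) (_≟ₑ_ K)
                                                   KP.edgeOpenPacking-resp-⊇ unique layers⊆edges
                                                   (layers-packing packing independent) ⟩
      ρₑᵒ K                                   ∎
      where
      open ≤-Reasoning
      -- Copies of different edges, or in different layers, differ, so the list length is a true
      -- cardinality.
      unique = Unique.cartesianProductWith⁺ layer layer-injective
        (Unique-resp-⊑ B⊑ GP.edges-unique) (Unique-resp-⊑ S⊑ HP.vertices-unique)
      layers⊆edges : cartesianProductWith layer B S ⊆ K.edges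
      layers⊆edges e∈ with _ , _ , f∈ , _ , refl ← ∈-cartesianProductWith⁻ layer B S e∈
        = layer∈edges (⊑-lookup B⊑ f∈)

-- Lower bounds for both products.

combine-monoʳ-< : ∀ {m n} (i : Fin m) {k l : Fin n} →
  k Fin.< l → combine i k Fin.< combine i l
combine-monoʳ-< {n = n} i {k} {l} k<l =
  subst₂ _<_ (sym (Fin.toℕ-combine i k)) (sym (Fin.toℕ-combine i l))
    (+-monoʳ-< (n * Fin.toℕ i) k<l)

module _ (G H : Graph) where
  private
    module G = Graph G
    module H = Graph H

  □-boundˡ : ρₑᵒ G * α H ≤ ρₑᵒ (G □ H)
  □-boundˡ = Layers.ρₑᵒ*α≤ρₑᵒ G H (G □ H) _,_ ,-injective
    (λ g~g′ → inj₁ (g~g′ , refl))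
    (λ { (inj₁ (g~g′ , h≡h′)) → inj₂ (h≡h′ , g~g′) ; (inj₂ (_ , h~h′)) → inj₁ h~h′ })
    -- Pairs are indexed lexicographically, so a larger first coordinate gives a larger index.
    (Fin.combine-monoˡ-< _ _)

  □-boundʳ : ρₑᵒ H * α G ≤ ρₑᵒ (G □ H)
  -- Now the layers are copies of `H`, one for each chosen vertex of `G`; flipping the pairing keeps
  -- the vertices of the product in their original form.
  □-boundʳ = Layers.ρₑᵒ*α≤ρₑᵒ H G (G □ H) (flip _,_) (swap ∘ ,-injective)
    (λ h~h′ → inj₂ (refl , h~h′))
    (λ { (inj₁ (g~g′ , _)) → inj₁ g~g′ ; (inj₂ p) → inj₂ p })
    (λ {_} {_} {g} → combine-monoʳ-< (Inverse.to G.index g))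

  ⊠-boundˡ : ρₑᵒ G * α H ≤ ρₑᵒ (G ⊠ H)
  ⊠-boundˡ = Layers.ρₑᵒ*α≤ρₑᵒ G H (G ⊠ H) _,_ ,-injective
    (λ g~g′ → inj₁ (inj₁ (g~g′ , refl)))
    (λ { (inj₁ (inj₁ (g~g′ , h≡h′))) → inj₂ (h≡h′ , g~g′)
       ; (inj₁ (inj₂ (_ , h~h′)))    → inj₁ h~h′
       ; (inj₂ (_ , h~h′))           → inj₁ h~h′ })
    (Fin.combine-monoˡ-< _ _)

  ⊠-boundʳ : ρₑᵒ H * α G ≤ ρₑᵒ (G ⊠ H)
  ⊠-boundʳ = Layers.ρₑᵒ*α≤ρₑᵒ H G (G ⊠ H) (flip _,_) (swap ∘ ,-injective)
    (λ h~h′ → inj₁ (inj₂ (refl , h~h′)))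
    (λ { (inj₁ (inj₁ (g~g′ , _))) → inj₁ g~g′
       ; (inj₁ (inj₂ p))          → inj₂ p
       ; (inj₂ (g~g′ , _))        → inj₁ g~g′ })
    (λ {_} {_} {g} → combine-monoʳ-< (Inverse.to G.index g))

-- Examples for sharpness.

completeGraph : ℕ → Graph
completeGraph n = record
  { V        = Fin n
  ; order    = n
  ; index    = ↔-id (Fin n)
  ; _~_      = _≢_
  ; _~?_     = λ u v → ¬? (u Fin.≟ v)
  ; ~-sym    = λ u≢v → u≢v ∘ sym
  ; ~-irrefl = λ u≢u → u≢u refl
  }

edgelessGraph : ℕ → Graph
edgelessGraph n = record
  { V        = Fin n
  ; order    = n
  ; index    = ↔-id (Fin n)
  ; _~_      = λ _ _ → ⊥
  ; _~?_     = λ _ _ → no λ()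
  ; ~-sym    = λ()
  ; ~-irrefl = λ()
  }

corollary5p3 : ((G H : Graph) →
    (ρₑᵒ (G □ H) ≥ (ρₑᵒ G * α H) ⊔ (α G * ρₑᵒ H))
    × (ρₑᵒ (G ⊠ H) ≥ (ρₑᵒ G * α H) ⊔ (ρₑᵒ H * α G)))
    × (∃[ G ] ∃[ H ] (Graph.order G > 0 × Graph.order H > 0
    × ρₑᵒ (G □ H) ≡ (ρₑᵒ G * α H) ⊔ (α G * ρₑᵒ H)))
    × (∃[ G ] ∃[ H ] (Graph.order G > 0 × Graph.order H > 0
    × ρₑᵒ (G ⊠ H) ≡ (ρₑᵒ G * α H) ⊔ (ρₑᵒ H * α G)))
corollary5p3 =
    (λ G H →
        ⊔-lub (□-boundˡ G H)
              (≤-trans (≤-reflexive (*-comm (α G) (ρₑᵒ H))) (□-boundʳ G H))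
      , ⊔-lub (⊠-boundˡ G H) (⊠-boundʳ G H))
  -- K₂ □ 2K₁ is two disjoint edges, and K₂ ⊠ K₂ is K₄, where every two edges are joined.
  , (completeGraph 2 , edgelessGraph 2 , s≤s z≤n , s≤s z≤n , refl)
  , (completeGraph 2 , completeGraph 2 , s≤s z≤n , s≤s z≤n , refl)
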